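{- Let $(\mathcal{C},\otimes,I,\alpha,\lambda,\rho)$ be a monoidal category with exponentials, i.e. for every object $A$ the functor $-\otimes A:\mathcal{C}\to\mathcal{C}$ has a right adjoint. If $\mathcal{C}$ has binary coproducts, and for each object $A$ of $\mathcal{C}$ the initial algebra of the endofunctor $X\mapsto I+A\otimes X$ exists, then for each object $A$ of $\mathcal{C}$ the free monoid $A^*$ on $A$ exists and its carrier is given by $\mu X.\ I+A\otimes X$, the carrier of the initial algebra of $X\mapsto I+A\otimes X$.
   Context: A monoid in a monoidal category is an object $M$ with morphisms $m:M\otimes M\to M$ and $e:I\to M$ satisfying the associativity and unit laws; a monoid homomorphism $(M_1,m_1,e_1)\to(M_2,m_2,e_2)$ is a morphism $f:M_1\to M_2$ with $f\circ e_1=e_2$ and $f\circ m_1=m_2\circ(f\otimes f)$. The free monoid on an object $A$ is a monoid $(F,m_F,e_F)$ together with a morphism $\mathrm{ins}:A\to F$ such that for every monoid $(G,m_G,e_G)$ and every morphism $f:A\to G$ in $\mathcal{C}$ there is a unique monoid homomorphism $\mathrm{free}\,f:F\to G$ with $(\mathrm{free}\,f)\circ\mathrm{ins}=f$. -}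

module Defs where

open import Level using (Level; suc; _⊔_)
open import Data.Product using (_×_; _,_; proj₁; proj₂; Σ-syntax)
open import Relation.Binary.Core using (Rel)
open import Relation.Binary.Structures using (IsEquivalence)

-- Hom-collections are setoids: equality of morphisms is the relation _≈_,
-- and every "unique" below is uniqueness up to _≈_.
record Category (o ℓ e : Level) : Set (suc (o ⊔ ℓ ⊔ e)) where
  infix  4 _≈_ _⇒_
  infixr 9 _∘_
  field
    Obj       : Set o
    _⇒_       : Obj → Obj → Set ℓ
    _≈_       : ∀ {A B} → Rel (A ⇒ B) e
    id        : ∀ {A} → A ⇒ A
    _∘_       : ∀ {A B C} → B ⇒ C → A ⇒ B → A ⇒ C
    assoc     : ∀ {A B C D} {f : A ⇒ B} {g : B ⇒ C} {h : C ⇒ D} →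
                (h ∘ g) ∘ f ≈ h ∘ (g ∘ f)
    identityˡ : ∀ {A B} {f : A ⇒ B} → id ∘ f ≈ f
    identityʳ : ∀ {A B} {f : A ⇒ B} → f ∘ id ≈ f
    equiv     : ∀ {A B} → IsEquivalence (_≈_ {A} {B})
    ∘-resp-≈  : ∀ {A B C} {f h : B ⇒ C} {g i : A ⇒ B} →
                f ≈ h → g ≈ i → f ∘ g ≈ h ∘ i

  module Equiv {A B : Obj} = IsEquivalence (equiv {A} {B})

record Functor {o ℓ e o′ ℓ′ e′ : Level}
               (C : Category o ℓ e) (D : Category o′ ℓ′ e′) :
               Set (o ⊔ ℓ ⊔ e ⊔ o′ ⊔ ℓ′ ⊔ e′) where
  private
    module C = Category C
    module D = Category D
  field
    F₀           : C.Obj → D.Obj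
    F₁           : ∀ {A B} → A C.⇒ B → F₀ A D.⇒ F₀ B
    identity     : ∀ {A} → F₁ (C.id {A}) D.≈ D.id
    homomorphism : ∀ {X Y Z} {f : X C.⇒ Y} {g : Y C.⇒ Z} →
                   F₁ (g C.∘ f) D.≈ F₁ g D.∘ F₁ f
    F-resp-≈     : ∀ {A B} {f g : A C.⇒ B} → f C.≈ g → F₁ f D.≈ F₁ g

module _ {o ℓ e o′ ℓ′ e′ : Level}
         {C : Category o ℓ e} {D : Category o′ ℓ′ e′} where
  private
    module C = Category C
    module D = Category D

  record _⊣_ (L : Functor C D) (R : Functor D C) :
             Set (o ⊔ ℓ ⊔ e ⊔ o′ ⊔ ℓ′ ⊔ e′) where
    private
      module L = Functor L
      module R = Functor R
    field
      unit           : ∀ X → X C.⇒ R.F₀ (L.F₀ X)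
      unit-natural   : ∀ {X Y} (f : X C.⇒ Y) →
                       unit Y C.∘ f C.≈ R.F₁ (L.F₁ f) C.∘ unit X
      counit         : ∀ Y → L.F₀ (R.F₀ Y) D.⇒ Y
      counit-natural : ∀ {X Y} (f : X D.⇒ Y) →
                       counit Y D.∘ L.F₁ (R.F₁ f) D.≈ f D.∘ counit X
      zig            : ∀ {X} → counit (L.F₀ X) D.∘ L.F₁ (unit X) D.≈ D.id
      zag            : ∀ {Y} → R.F₁ (counit Y) C.∘ unit (R.F₀ Y) C.≈ C.id

  HasRightAdjoint : Functor C D → Set (o ⊔ ℓ ⊔ e ⊔ o′ ⊔ ℓ′ ⊔ e′)
  HasRightAdjoint L = Σ[ R ∈ Functor D C ] (L ⊣ R)

Product : {o ℓ e o′ ℓ′ e′ : Level} →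
          Category o ℓ e → Category o′ ℓ′ e′ →
          Category (o ⊔ o′) (ℓ ⊔ ℓ′) (e ⊔ e′)
Product C D = record
  { Obj       = C.Obj × D.Obj
  ; _⇒_       = λ (A , A′) (B , B′) → (A C.⇒ B) × (A′ D.⇒ B′)
  ; _≈_       = λ (f , f′) (g , g′) → (f C.≈ g) × (f′ D.≈ g′)
  ; id        = C.id , D.id
  ; _∘_       = λ (g , g′) (f , f′) → (g C.∘ f) , (g′ D.∘ f′)
  ; assoc     = C.assoc , D.assoc
  ; identityˡ = C.identityˡ , D.identityˡ
  ; identityʳ = C.identityʳ , D.identityʳ
  ; equiv     = record
    { refl  = C.Equiv.refl , D.Equiv.refl
    ; sym   = λ (p , q) → C.Equiv.sym p , D.Equiv.sym q
    ; trans = λ (p , q) (p′ , q′) → C.Equiv.trans p p′ , D.Equiv.trans q q′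
    }
  ; ∘-resp-≈  = λ (p , q) (p′ , q′) → C.∘-resp-≈ p p′ , D.∘-resp-≈ q q′
  }
  where
    module C = Category C
    module D = Category D

module _ {o ℓ e : Level} (C : Category o ℓ e) where
  open Category C

  record _≅_ (A B : Obj) : Set (ℓ ⊔ e) where
    field
      from : A ⇒ B
      to   : B ⇒ A
      isoˡ : to ∘ from ≈ id
      isoʳ : from ∘ to ≈ id

  record Coproduct (A B : Obj) : Set (o ⊔ ℓ ⊔ e) where
    field
      A+B     : Obj
      i₁      : A ⇒ A+B
      i₂      : B ⇒ A+B
      [_,_]   : ∀ {X} → A ⇒ X → B ⇒ X → A+B ⇒ X
      inject₁ : ∀ {X} {f : A ⇒ X} {g : B ⇒ X} → [ f , g ] ∘ i₁ ≈ f
      inject₂ : ∀ {X} {f : A ⇒ X} {g : B ⇒ X} → [ f , g ] ∘ i₂ ≈ g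
      unique  : ∀ {X} {f : A ⇒ X} {g : B ⇒ X} {h : A+B ⇒ X} →
                h ∘ i₁ ≈ f → h ∘ i₂ ≈ g → h ≈ [ f , g ]

  BinaryCoproducts : Set (o ⊔ ℓ ⊔ e)
  BinaryCoproducts = ∀ A B → Coproduct A B

  record Monoidal : Set (o ⊔ ℓ ⊔ e) where
    field
      ⊗ : Functor (Product C C) C
      I : Obj

    infixr 10 _⊗₀_ _⊗₁_

    _⊗₀_ : Obj → Obj → Obj
    A ⊗₀ B = Functor.F₀ ⊗ (A , B)

    _⊗₁_ : ∀ {A B A′ B′} → A ⇒ B → A′ ⇒ B′ → A ⊗₀ A′ ⇒ B ⊗₀ B′
    f ⊗₁ g = Functor.F₁ ⊗ (f , g)

    field
      associator : ∀ X Y Z → _≅_ ((X ⊗₀ Y) ⊗₀ Z) (X ⊗₀ (Y ⊗₀ Z))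
      unitorˡ    : ∀ X → _≅_ (I ⊗₀ X) X
      unitorʳ    : ∀ X → _≅_ (X ⊗₀ I) X

    α : ∀ {X Y Z} → (X ⊗₀ Y) ⊗₀ Z ⇒ X ⊗₀ (Y ⊗₀ Z)
    α {X} {Y} {Z} = _≅_.from (associator X Y Z)

    λ′ : ∀ {X} → I ⊗₀ X ⇒ X
    λ′ {X} = _≅_.from (unitorˡ X)

    ρ : ∀ {X} → X ⊗₀ I ⇒ X
    ρ {X} = _≅_.from (unitorʳ X)

    field
      α-natural : ∀ {X X′ Y Y′ Z Z′}
                  (f : X ⇒ X′) (g : Y ⇒ Y′) (h : Z ⇒ Z′) →
                  α ∘ ((f ⊗₁ g) ⊗₁ h) ≈ (f ⊗₁ (g ⊗₁ h)) ∘ α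
      λ-natural : ∀ {X Y} (f : X ⇒ Y) → λ′ ∘ (id ⊗₁ f) ≈ f ∘ λ′
      ρ-natural : ∀ {X Y} (f : X ⇒ Y) → ρ ∘ (f ⊗₁ id) ≈ f ∘ ρ
      triangle  : ∀ {X Y} → (id {X} ⊗₁ λ′ {Y}) ∘ α ≈ ρ ⊗₁ id
      pentagon  : ∀ {W X Y Z} →
                  (id {W} ⊗₁ α {X} {Y} {Z}) ∘ (α ∘ (α ⊗₁ id)) ≈ α ∘ α

module _ {o ℓ e : Level} {C : Category o ℓ e} where
  open Category C

  record Algebra (F : Functor C C) : Set (o ⊔ ℓ) where
    field
      carrier   : Obj
      structure : Functor.F₀ F carrier ⇒ carrier

  record AlgebraHom {F : Functor C C} (X Y : Algebra F) : Set (ℓ ⊔ e) where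
    private
      module X = Algebra X
      module Y = Algebra Y
    field
      hom      : X.carrier ⇒ Y.carrier
      commutes : hom ∘ X.structure ≈ Y.structure ∘ Functor.F₁ F hom

  record InitialAlgebra (F : Functor C C) : Set (o ⊔ ℓ ⊔ e) where
    field
      algebra : Algebra F
      fold    : (X : Algebra F) → AlgebraHom algebra X
      unique  : (X : Algebra F) (g : AlgebraHom algebra X) →
                AlgebraHom.hom g ≈ AlgebraHom.hom (fold X)

    open Algebra algebra public

module _ {o ℓ e : Level} {C : Category o ℓ e} (V : Monoidal C) where
  open Category C
  open Monoidal V

  -⊗_ : Obj → Functor C C
  -⊗ A = record
    { F₀           = λ X → X ⊗₀ A
    ; F₁           = λ f → f ⊗₁ id
    ; identity     = Functor.identity ⊗
    ; homomorphism = Equiv.trans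
        (Functor.F-resp-≈ ⊗ (Equiv.refl , Equiv.sym identityˡ))
        (Functor.homomorphism ⊗)
    ; F-resp-≈     = λ p → Functor.F-resp-≈ ⊗ (p , Equiv.refl)
    }

  HasExponentials : Set (o ⊔ ℓ ⊔ e)
  HasExponentials = ∀ A → HasRightAdjoint (-⊗ A)

  module _ (coproducts : BinaryCoproducts C) where

    I+_⊗- : Obj → Functor C C
    I+ A ⊗- = record
      { F₀           = λ X → Coproduct.A+B (cop X)
      ; F₁           = F₁
      ; identity     = λ {X} → Equiv.sym (Coproduct.unique (cop X)
          identityˡ
          (Equiv.trans identityˡ (Equiv.trans (Equiv.sym identityʳ)
            (∘-resp-≈ Equiv.refl (Equiv.sym (Functor.identity ⊗))))))
      ; homomorphism = λ {X} {Y} {Z} {f} {g} →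
          Equiv.sym (Coproduct.unique (cop X)
            (Equiv.trans assoc (Equiv.trans
              (∘-resp-≈ Equiv.refl (Coproduct.inject₁ (cop X)))
              (Coproduct.inject₁ (cop Y))))
            (Equiv.trans assoc (Equiv.trans
              (∘-resp-≈ Equiv.refl (Coproduct.inject₂ (cop X)))
              (Equiv.trans (Equiv.sym assoc) (Equiv.trans
                (∘-resp-≈ (Coproduct.inject₂ (cop Y)) Equiv.refl)
                (Equiv.trans assoc (∘-resp-≈ Equiv.refl
                  (Equiv.trans (Equiv.sym (Functor.homomorphism ⊗))
                    (Functor.F-resp-≈ ⊗ (identityˡ , Equiv.refl))))))))))
      ; F-resp-≈     = λ {X} p → Coproduct.unique (cop X)
          (Coproduct.inject₁ (cop X))
          (Equiv.trans (Coproduct.inject₂ (cop X))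
            (∘-resp-≈ Equiv.refl (Functor.F-resp-≈ ⊗ (Equiv.refl , p))))
      }
      where
        cop : ∀ X → Coproduct C I (A ⊗₀ X)
        cop X = coproducts I (A ⊗₀ X)

        F₁ : ∀ {X Y} → X ⇒ Y →
             Coproduct.A+B (cop X) ⇒ Coproduct.A+B (cop Y)
        F₁ {X} {Y} f =
          Coproduct.[_,_] (cop X) (Coproduct.i₁ (cop Y))
                                  (Coproduct.i₂ (cop Y) ∘ (id ⊗₁ f))

  record Monoid : Set (o ⊔ ℓ ⊔ e) where
    field
      carrier    : Obj
      mult       : carrier ⊗₀ carrier ⇒ carrier
      unit       : I ⇒ carrier
      mult-assoc : mult ∘ (mult ⊗₁ id) ≈ mult ∘ ((id ⊗₁ mult) ∘ α)
      unitˡ      : mult ∘ (unit ⊗₁ id) ≈ λ′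
      unitʳ      : mult ∘ (id ⊗₁ unit) ≈ ρ

  record MonoidHom (M N : Monoid) : Set (ℓ ⊔ e) where
    private
      module M = Monoid M
      module N = Monoid N
    field
      hom            : M.carrier ⇒ N.carrier
      preserves-unit : hom ∘ M.unit ≈ N.unit
      preserves-mult : hom ∘ M.mult ≈ N.mult ∘ (hom ⊗₁ hom)

  record FreeMonoid (A : Obj) : Set (o ⊔ ℓ ⊔ e) where
    field
      monoid : Monoid

    open Monoid monoid public

    field
      ins      : A ⇒ carrier
      free     : (G : Monoid) → A ⇒ Monoid.carrier G → MonoidHom monoid G
      free-ins : (G : Monoid) (f : A ⇒ Monoid.carrier G) →
                 MonoidHom.hom (free G f) ∘ ins ≈ f
      unique   : (G : Monoid) (f : A ⇒ Monoid.carrier G)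
                 (h : MonoidHom monoid G) →
                 MonoidHom.hom h ∘ ins ≈ f →
                 MonoidHom.hom h ≈ MonoidHom.hom (free G f)

{-# OPTIONS --safe #-}

-- Write nil : I → F and cons : A ⊗ F → F for the two components of the
-- initial algebra F = μX. I + A ⊗ X.  Transposing along - ⊗ X ⊣ X ⇒ -
-- upgrades initiality to recursion with a parameter: maps F ⊗ X → Y are
-- uniquely determined by a map X → Y and an action A ⊗ Y → Y.
-- Concatenation F ⊗ F → F is defined by this recursion, and every monoid or
-- homomorphism law is an instance of its uniqueness.  The unit and
-- associativity laws need the unit coherences of Kelly (λ and ρ against α, and
-- λ_I = ρ_I), which follow from the triangle and the pentagon.

module Submission where

open import Level using (Level)
open import Data.Product using (Σ-syntax; _,_; proj₁; proj₂)
open import Relation.Binary.Bundles using (Setoid)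
open import Relation.Binary.PropositionalEquality using (_≡_; refl)
import Relation.Binary.Reasoning.Setoid as SetoidReasoning
open import Defs

-- Equational reasoning in a category.

module CategoryReasoning {o ℓ e : Level} (C : Category o ℓ e) where
  open Category C

  infixr 4 refl⟩∘⟨_
  infixl 5 _⟩∘⟨refl

  hom-setoid : Obj → Obj → Setoid ℓ e
  hom-setoid A B = record { isEquivalence = equiv {A} {B} }

  open module HomReasoning {A B : Obj} = SetoidReasoning (hom-setoid A B) public

  refl⟩∘⟨_ : ∀ {A B D} {f : B ⇒ D} {g i : A ⇒ B} → g ≈ i → f ∘ g ≈ f ∘ i
  refl⟩∘⟨ p = ∘-resp-≈ Equiv.refl p

  _⟩∘⟨refl : ∀ {A B D} {f h : B ⇒ D} {g : A ⇒ B} → f ≈ h → f ∘ g ≈ h ∘ g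
  p ⟩∘⟨refl = ∘-resp-≈ p Equiv.refl

  pullˡ : ∀ {A B D E} {f : D ⇒ E} {g : B ⇒ D} {h : B ⇒ E} {k : A ⇒ B} →
          f ∘ g ≈ h → f ∘ (g ∘ k) ≈ h ∘ k
  pullˡ p = Equiv.trans (Equiv.sym assoc) (p ⟩∘⟨refl)

  pullʳ : ∀ {A B D E} {f : D ⇒ E} {g : B ⇒ D} {h : A ⇒ D} {k : A ⇒ B} →
          g ∘ k ≈ h → (f ∘ g) ∘ k ≈ f ∘ h
  pullʳ p = Equiv.trans assoc (refl⟩∘⟨ p)

  extendʳ : ∀ {A B D D′ E} {f : D ⇒ E} {g : B ⇒ D} {h : D′ ⇒ E} {i : B ⇒ D′}
            {k : A ⇒ B} → f ∘ g ≈ h ∘ i → f ∘ (g ∘ k) ≈ h ∘ (i ∘ k)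
  extendʳ p = Equiv.trans (pullˡ p) assoc

  module _ {A B : Obj} (i : _≅_ C A B) where
    open _≅_ i

    iso-monic : ∀ {X} {f g : X ⇒ A} → from ∘ f ≈ from ∘ g → f ≈ g
    iso-monic {f = f} {g} p = begin
      f                 ≈⟨ identityˡ ⟨
      id ∘ f            ≈⟨ pullˡ isoˡ ⟨
      to ∘ (from ∘ f)   ≈⟨ refl⟩∘⟨ p ⟩
      to ∘ (from ∘ g)   ≈⟨ pullˡ isoˡ ⟩
      id ∘ g            ≈⟨ identityˡ ⟩
      g                 ∎

    iso-epic : ∀ {X} {f g : B ⇒ X} → f ∘ from ≈ g ∘ from → f ≈ g
    iso-epic {f = f} {g} p = begin
      f                 ≈⟨ identityʳ ⟨
      f ∘ id            ≈⟨ pullʳ isoʳ ⟨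
      (f ∘ from) ∘ to   ≈⟨ p ⟩∘⟨refl ⟩
      (g ∘ from) ∘ to   ≈⟨ pullʳ isoʳ ⟩
      g ∘ id            ≈⟨ identityʳ ⟩
      g                 ∎

-- Whiskering, naturality and unit coherence in a monoidal category.

module MonoidalReasoning {o ℓ e : Level} {C : Category o ℓ e} (V : Monoidal C) where
  open Category C
  open CategoryReasoning C
  open Monoidal V

  α⁻¹ : ∀ {X Y Z} → X ⊗₀ (Y ⊗₀ Z) ⇒ (X ⊗₀ Y) ⊗₀ Z
  α⁻¹ {X} {Y} {Z} = _≅_.to (associator X Y Z)

  ρ⁻¹ : ∀ {X} → X ⇒ X ⊗₀ I
  ρ⁻¹ {X} = _≅_.to (unitorʳ X)

  ⊗-resp : ∀ {A B A′ B′} {f g : A ⇒ B} {h k : A′ ⇒ B′} →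
           f ≈ g → h ≈ k → f ⊗₁ h ≈ g ⊗₁ k
  ⊗-resp p q = Functor.F-resp-≈ ⊗ (p , q)

  ⊗-respˡ : ∀ {A B A′ B′} {f g : A ⇒ B} {h : A′ ⇒ B′} → f ≈ g → f ⊗₁ h ≈ g ⊗₁ h
  ⊗-respˡ p = ⊗-resp p Equiv.refl

  ⊗-respʳ : ∀ {A B A′ B′} {f : A ⇒ B} {h k : A′ ⇒ B′} → h ≈ k → f ⊗₁ h ≈ f ⊗₁ k
  ⊗-respʳ p = ⊗-resp Equiv.refl p

  ⊗-id : ∀ {A B} → id {A} ⊗₁ id {B} ≈ id
  ⊗-id = Functor.identity ⊗

  ⊗-merge : ∀ {A B D A′ B′ D′} {f : B ⇒ D} {g : A ⇒ B} {p : A ⇒ D}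
            {h : B′ ⇒ D′} {k : A′ ⇒ B′} {q : A′ ⇒ D′} →
            f ∘ g ≈ p → h ∘ k ≈ q → (f ⊗₁ h) ∘ (g ⊗₁ k) ≈ p ⊗₁ q
  ⊗-merge p q = Equiv.trans (Equiv.sym (Functor.homomorphism ⊗)) (⊗-resp p q)

  ⊗-mergeˡ : ∀ {A B D X} {f : B ⇒ D} {g : A ⇒ B} {p : A ⇒ D} →
             f ∘ g ≈ p → (f ⊗₁ id {X}) ∘ (g ⊗₁ id) ≈ p ⊗₁ id
  ⊗-mergeˡ p = ⊗-merge p identityˡ

  ⊗-mergeʳ : ∀ {A B D X} {f : B ⇒ D} {g : A ⇒ B} {p : A ⇒ D} →
             f ∘ g ≈ p → (id {X} ⊗₁ f) ∘ (id ⊗₁ g) ≈ id ⊗₁ p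
  ⊗-mergeʳ p = ⊗-merge identityˡ p

  ⊗-interchange : ∀ {A B A′ B′} {f : A ⇒ B} {g : A′ ⇒ B′} →
                  (f ⊗₁ id) ∘ (id ⊗₁ g) ≈ (id ⊗₁ g) ∘ (f ⊗₁ id)
  ⊗-interchange = Equiv.trans (⊗-merge identityʳ identityˡ)
                              (Equiv.sym (⊗-merge identityˡ identityʳ))

  α-naturalˡ : ∀ {X X′ Y Z} (f : X ⇒ X′) →
               α {X′} {Y} {Z} ∘ ((f ⊗₁ id) ⊗₁ id) ≈ (f ⊗₁ id) ∘ α
  α-naturalˡ f = Equiv.trans (α-natural f id id) (⊗-respʳ ⊗-id ⟩∘⟨refl)

  α-naturalʳ : ∀ {X Y Z Z′} (f : Z ⇒ Z′) →
               α {X} {Y} {Z′} ∘ (id ⊗₁ f) ≈ (id ⊗₁ (id ⊗₁ f)) ∘ α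
  α-naturalʳ f = Equiv.trans (refl⟩∘⟨ ⊗-respˡ (Equiv.sym ⊗-id)) (α-natural id id f)

  α⁻¹-naturalˡ : ∀ {X X′ Y Z} (f : X ⇒ X′) →
                 α⁻¹ {X′} {Y} {Z} ∘ (f ⊗₁ id) ≈ ((f ⊗₁ id) ⊗₁ id) ∘ α⁻¹
  α⁻¹-naturalˡ f = iso-monic (associator _ _ _) (begin
    α ∘ (α⁻¹ ∘ (f ⊗₁ id))                ≈⟨ pullˡ (_≅_.isoʳ (associator _ _ _)) ⟩
    id ∘ (f ⊗₁ id)                       ≈⟨ identityˡ ⟩
    f ⊗₁ id                              ≈⟨ identityʳ ⟨
    (f ⊗₁ id) ∘ id                       ≈⟨ refl⟩∘⟨ _≅_.isoʳ (associator _ _ _) ⟨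
    (f ⊗₁ id) ∘ (α ∘ α⁻¹)                ≈⟨ extendʳ (α-naturalˡ f) ⟨
    α ∘ (((f ⊗₁ id) ⊗₁ id) ∘ α⁻¹)        ∎)

  -- Naturality makes `id ⊗₁ f` the conjugate of `f` by the isomorphism `λ′`. This allows a
  -- coherence equation to be checked after tensoring with `I`, where the triangle and the pentagon
  -- apply.
  I⊗-faithful : ∀ {X Y} {f g : X ⇒ Y} → id {I} ⊗₁ f ≈ id ⊗₁ g → f ≈ g
  I⊗-faithful {f = f} {g} p = iso-epic (unitorˡ _) (begin
    f ∘ λ′           ≈⟨ λ-natural f ⟨
    λ′ ∘ (id ⊗₁ f)   ≈⟨ refl⟩∘⟨ p ⟩
    λ′ ∘ (id ⊗₁ g)   ≈⟨ λ-natural g ⟩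
    g ∘ λ′           ∎)

  ⊗I-faithful : ∀ {X Y} {f g : X ⇒ Y} → f ⊗₁ id {I} ≈ g ⊗₁ id → f ≈ g
  ⊗I-faithful {f = f} {g} p = iso-epic (unitorʳ _) (begin
    f ∘ ρ            ≈⟨ ρ-natural f ⟨
    ρ ∘ (f ⊗₁ id)    ≈⟨ refl⟩∘⟨ p ⟩
    ρ ∘ (g ⊗₁ id)    ≈⟨ ρ-natural g ⟩
    g ∘ ρ            ∎)

  ⊗-iso : ∀ {A B X} → _≅_ C A B → _≅_ C (A ⊗₀ X) (B ⊗₀ X)
  ⊗-iso i = record
    { from = from ⊗₁ id
    ; to   = to ⊗₁ id
    ; isoˡ = Equiv.trans (⊗-mergeˡ isoˡ) ⊗-id
    ; isoʳ = Equiv.trans (⊗-mergeˡ isoʳ) ⊗-id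
    }
    where open _≅_ i

  -- After tensoring with `I` on the left and precomposing with two associators, the two sides are
  -- joined by the pentagon whose first two objects are `I`, with the triangle used once on either
  -- side of it.
  λ-α : ∀ {X Y} → λ′ {X ⊗₀ Y} ∘ α ≈ λ′ ⊗₁ id
  λ-α = I⊗-faithful (iso-epic (associator _ _ _) (iso-epic (⊗-iso (associator _ _ _)) (begin
    ((id ⊗₁ (λ′ ∘ α)) ∘ α) ∘ (α ⊗₁ id)           ≈⟨ assoc ⟩
    (id ⊗₁ (λ′ ∘ α)) ∘ (α ∘ (α ⊗₁ id))           ≈⟨ ⊗-mergeʳ Equiv.refl ⟩∘⟨refl ⟨
    ((id ⊗₁ λ′) ∘ (id ⊗₁ α)) ∘ (α ∘ (α ⊗₁ id))   ≈⟨ pullʳ pentagon ⟩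
    (id ⊗₁ λ′) ∘ (α ∘ α)                         ≈⟨ pullˡ triangle ⟩
    (ρ ⊗₁ id) ∘ α                                ≈⟨ α-naturalˡ ρ ⟨
    α ∘ ((ρ ⊗₁ id) ⊗₁ id)                        ≈⟨ refl⟩∘⟨ ⊗-mergeˡ triangle ⟨
    α ∘ (((id ⊗₁ λ′) ⊗₁ id) ∘ (α ⊗₁ id))         ≈⟨ pullˡ (α-natural id λ′ id) ⟩
    ((id ⊗₁ (λ′ ⊗₁ id)) ∘ α) ∘ (α ⊗₁ id)         ∎)))

  -- The mirror image of `λ-α`: tensor with `I` on the right and use the pentagon whose last two
  -- objects are `I`.
  ρ-α : ∀ {X Y} → (id {X} ⊗₁ ρ {Y}) ∘ α ≈ ρ
  ρ-α = ⊗I-faithful (iso-monic (associator _ _ _) (begin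
    α ∘ (((id ⊗₁ ρ) ∘ α) ⊗₁ id)                       ≈⟨ refl⟩∘⟨ ⊗-mergeˡ Equiv.refl ⟨
    α ∘ (((id ⊗₁ ρ) ⊗₁ id) ∘ (α ⊗₁ id))               ≈⟨ extendʳ (α-natural id ρ id) ⟩
    (id ⊗₁ (ρ ⊗₁ id)) ∘ (α ∘ (α ⊗₁ id))               ≈⟨ ⊗-mergeʳ triangle ⟩∘⟨refl ⟨
    ((id ⊗₁ (id ⊗₁ λ′)) ∘ (id ⊗₁ α)) ∘ (α ∘ (α ⊗₁ id)) ≈⟨ pullʳ pentagon ⟩
    (id ⊗₁ (id ⊗₁ λ′)) ∘ (α ∘ α)                      ≈⟨ extendʳ (α-naturalʳ λ′) ⟨
    α ∘ ((id ⊗₁ λ′) ∘ α)                              ≈⟨ refl⟩∘⟨ triangle ⟩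
    α ∘ (ρ ⊗₁ id)                                     ∎))

  λ-I⊗ : ∀ {X} → λ′ {I ⊗₀ X} ≈ id ⊗₁ λ′
  λ-I⊗ = iso-monic (unitorˡ _) (Equiv.sym (λ-natural λ′))

  -- After tensoring with `I`, `λ-α` computes the left side and `triangle` the right; `λ-I⊗`
  -- identifies the two unitors that they start from.
  λ≈ρ : λ′ {I} ≈ ρ
  λ≈ρ = ⊗I-faithful (begin
    λ′ ⊗₁ id         ≈⟨ λ-α ⟨
    λ′ ∘ α           ≈⟨ λ-I⊗ ⟩∘⟨refl ⟩
    (id ⊗₁ λ′) ∘ α   ≈⟨ triangle ⟩
    ρ ⊗₁ id          ∎)

  -- The pentagon with one associator on each side moved across, in the shape that arises in the
  -- `cons` case of associativity.
  pentagon⁻¹ : ∀ {W X Y Z} →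
               α {W} {X ⊗₀ Y} {Z} ∘ ((α ⊗₁ id) ∘ α⁻¹) ≈ (id ⊗₁ α⁻¹) ∘ α
  pentagon⁻¹ = iso-epic (associator _ _ _) (begin
    (α ∘ ((α ⊗₁ id) ∘ α⁻¹)) ∘ α                     ≈⟨ pullʳ (pullʳ (_≅_.isoˡ (associator _ _ _))) ⟩
    α ∘ ((α ⊗₁ id) ∘ id)                            ≈⟨ refl⟩∘⟨ identityʳ ⟩
    α ∘ (α ⊗₁ id)                                   ≈⟨ identityˡ ⟨
    id ∘ (α ∘ (α ⊗₁ id))                            ≈⟨ ⊗-id ⟩∘⟨refl ⟨
    (id ⊗₁ id) ∘ (α ∘ (α ⊗₁ id))                    ≈⟨ ⊗-mergeʳ (_≅_.isoˡ (associator _ _ _)) ⟩∘⟨refl ⟨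
    ((id ⊗₁ α⁻¹) ∘ (id ⊗₁ α)) ∘ (α ∘ (α ⊗₁ id))     ≈⟨ pullʳ pentagon ⟩
    (id ⊗₁ α⁻¹) ∘ (α ∘ α)                           ≈⟨ assoc ⟨
    ((id ⊗₁ α⁻¹) ∘ α) ∘ α                           ∎)

-- Transposition along the exponential adjunction.

module Transpose {o ℓ e : Level} {C : Category o ℓ e} (V : Monoidal C)
                 (exponentials : HasExponentials V) (X : Category.Obj C) where
  open Category C
  open CategoryReasoning C
  open Monoidal V
  open MonoidalReasoning V
  private
    module R = Functor (proj₁ (exponentials X))
    module Adj = _⊣_ (proj₂ (exponentials X))

  [X,_] : Obj → Obj
  [X,_] = R.F₀

  eval : ∀ {Y} → [X, Y ] ⊗₀ X ⇒ Y
  eval = Adj.counit _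

  curry : ∀ {Z Y} → Z ⊗₀ X ⇒ Y → Z ⇒ [X, Y ]
  curry h = R.F₁ h ∘ Adj.unit _

  uncurry : ∀ {Z Y} → Z ⇒ [X, Y ] → Z ⊗₀ X ⇒ Y
  uncurry g = eval ∘ (g ⊗₁ id)

  curry-resp : ∀ {Z Y} {h k : Z ⊗₀ X ⇒ Y} → h ≈ k → curry h ≈ curry k
  curry-resp p = R.F-resp-≈ p ⟩∘⟨refl

  uncurry-resp : ∀ {Z Y} {g k : Z ⇒ [X, Y ]} → g ≈ k → uncurry g ≈ uncurry k
  uncurry-resp p = refl⟩∘⟨ ⊗-respˡ p

  -- Naturality of the counit pulls `h` out and leaves a triangle identity. As a consequence `curry`
  -- is injective, which is how uniqueness of folds passes to folds with a parameter.
  uncurry-curry : ∀ {Z Y} (h : Z ⊗₀ X ⇒ Y) → uncurry (curry h) ≈ h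
  uncurry-curry h = begin
    eval ∘ ((R.F₁ h ∘ Adj.unit _) ⊗₁ id)             ≈⟨ refl⟩∘⟨ ⊗-mergeˡ Equiv.refl ⟨
    eval ∘ ((R.F₁ h ⊗₁ id) ∘ (Adj.unit _ ⊗₁ id))     ≈⟨ extendʳ (Adj.counit-natural h) ⟩
    h ∘ (eval ∘ (Adj.unit _ ⊗₁ id))                  ≈⟨ refl⟩∘⟨ Adj.zig ⟩
    h ∘ id                                           ≈⟨ identityʳ ⟩
    h                                                ∎

  curry-natural : ∀ {W Z Y} (h : Z ⊗₀ X ⇒ Y) (g : W ⇒ Z) →
                  curry h ∘ g ≈ curry (h ∘ (g ⊗₁ id))
  curry-natural h g = begin
    (R.F₁ h ∘ Adj.unit _) ∘ g                        ≈⟨ pullʳ (Adj.unit-natural g) ⟩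
    R.F₁ h ∘ (R.F₁ (g ⊗₁ id) ∘ Adj.unit _)           ≈⟨ pullˡ (Equiv.sym R.homomorphism) ⟩
    R.F₁ (h ∘ (g ⊗₁ id)) ∘ Adj.unit _                ∎

  uncurry-natural : ∀ {W Z Y} (h : Z ⇒ [X, Y ]) (g : W ⇒ Z) →
                    uncurry h ∘ (g ⊗₁ id) ≈ uncurry (h ∘ g)
  uncurry-natural h g = pullʳ (⊗-mergeˡ Equiv.refl)

-- Recursion on the initial algebra and the free monoid.

module FreeMonoidConstruction
  {o ℓ e : Level} {C : Category o ℓ e} (V : Monoidal C)
  (exponentials : HasExponentials V) (coproducts : BinaryCoproducts C)
  (A : Category.Obj C) (μA : InitialAlgebra (I+_⊗- V coproducts A)) where
  open Category C
  open CategoryReasoning C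
  open Monoidal V
  open MonoidalReasoning V

  F : Obj
  F = InitialAlgebra.carrier μA

  private
    module Sum (X : Obj) = Coproduct (coproducts I (A ⊗₀ X))

  nil : I ⇒ F
  nil = InitialAlgebra.structure μA ∘ Sum.i₁ F

  cons : A ⊗₀ F ⇒ F
  cons = InitialAlgebra.structure μA ∘ Sum.i₂ F

  module _ {Y : Obj} (z : I ⇒ Y) (s : A ⊗₀ Y ⇒ Y) where

    -- Algebra homomorphisms split along the coproduct into one equation per constructor, so that
    -- later arguments never mention copairing.
    IsFold : F ⇒ Y → Set e
    IsFold h = Σ[ _ ∈ h ∘ nil ≈ z ] (h ∘ cons ≈ s ∘ (id ⊗₁ h))

    private
      target : Algebra (I+_⊗- V coproducts A)
      target = record { carrier = Y ; structure = Sum.[_,_] Y z s }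

      module Target = InitialAlgebra μA

      toHom : (h : F ⇒ Y) → IsFold h → AlgebraHom Target.algebra target
      toHom h (h-nil , h-cons) = record
        { hom      = h
        -- Both sides equal the copairing of `z` and `s ∘ (id ⊗₁ h)`.
        ; commutes = Equiv.trans
            (Sum.unique F (Equiv.trans assoc h-nil) (Equiv.trans assoc h-cons))
            (Equiv.sym (Sum.unique F
              (Equiv.trans (pullʳ (Sum.inject₁ F)) (Sum.inject₁ Y))
              (Equiv.trans (pullʳ (Sum.inject₂ F)) (pullˡ (Sum.inject₂ Y)))))
        }

    fold : F ⇒ Y
    fold = AlgebraHom.hom (Target.fold target)

    fold-isFold : IsFold fold
    fold-isFold =
      Equiv.trans (extendʳ commutes)
        (Equiv.trans (refl⟩∘⟨ Sum.inject₁ F) (Sum.inject₁ Y)) ,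
      Equiv.trans (extendʳ commutes)
        (Equiv.trans (refl⟩∘⟨ Sum.inject₂ F) (pullˡ (Sum.inject₂ Y)))
      where open AlgebraHom (Target.fold target)

    fold-unique : ∀ {h k} → IsFold h → IsFold k → h ≈ k
    fold-unique p q = Equiv.trans (Target.unique target (toHom _ p))
                                  (Equiv.sym (Target.unique target (toHom _ q)))

  module _ {X Y : Obj} (z : X ⇒ Y) (s : A ⊗₀ Y ⇒ Y) where
    open Transpose V exponentials X

    -- The parameter `X` is used once, at `nil`. At `cons`, `α` rebrackets so that the recursive
    -- call receives the tail together with the parameter.
    IsParamFold : F ⊗₀ X ⇒ Y → Set e
    IsParamFold h = Σ[ _ ∈ h ∘ (nil ⊗₁ id) ≈ z ∘ λ′ ]
                      (h ∘ (cons ⊗₁ id) ≈ s ∘ ((id ⊗₁ h) ∘ α))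

    private
      -- `nil′` and `cons′` transpose the two equations of `IsParamFold`, making `[X, Y ]` the
      -- target of an ordinary fold.
      nil′ : I ⇒ [X, Y ]
      nil′ = curry (z ∘ λ′)

      cons′ : A ⊗₀ [X, Y ] ⇒ [X, Y ]
      cons′ = curry (s ∘ ((id ⊗₁ eval) ∘ α))

      -- Translates the `cons` equation between its curried and uncurried forms, for both existence
      -- and uniqueness.
      cons′-natural : ∀ {Z} (g : Z ⇒ [X, Y ]) →
                      cons′ ∘ (id ⊗₁ g) ≈ curry (s ∘ ((id ⊗₁ uncurry g) ∘ α))
      cons′-natural g = Equiv.trans (curry-natural _ _) (curry-resp (begin
        (s ∘ ((id ⊗₁ eval) ∘ α)) ∘ ((id ⊗₁ g) ⊗₁ id)     ≈⟨ pullʳ assoc ⟩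
        s ∘ ((id ⊗₁ eval) ∘ (α ∘ ((id ⊗₁ g) ⊗₁ id)))     ≈⟨ refl⟩∘⟨ refl⟩∘⟨ α-natural id g id ⟩
        s ∘ ((id ⊗₁ eval) ∘ ((id ⊗₁ (g ⊗₁ id)) ∘ α))     ≈⟨ refl⟩∘⟨ pullˡ (⊗-mergeʳ Equiv.refl) ⟩
        s ∘ ((id ⊗₁ uncurry g) ∘ α)                      ∎))

      curry-isFold : ∀ {h} → IsParamFold h → IsFold nil′ cons′ (curry h)
      curry-isFold {h} (h-nil , h-cons) =
        Equiv.trans (curry-natural h nil) (curry-resp h-nil) , (begin
          curry h ∘ cons                                    ≈⟨ curry-natural h cons ⟩
          curry (h ∘ (cons ⊗₁ id))                          ≈⟨ curry-resp h-cons ⟩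
          curry (s ∘ ((id ⊗₁ h) ∘ α))                       ≈⟨ curry-resp (refl⟩∘⟨ ⊗-respʳ (uncurry-curry h) ⟩∘⟨refl) ⟨
          curry (s ∘ ((id ⊗₁ uncurry (curry h)) ∘ α))       ≈⟨ cons′-natural (curry h) ⟨
          cons′ ∘ (id ⊗₁ curry h)                           ∎)

    paramFold : F ⊗₀ X ⇒ Y
    paramFold = uncurry (fold nil′ cons′)

    paramFold-isParamFold : IsParamFold paramFold
    paramFold-isParamFold = (begin
        uncurry g ∘ (nil ⊗₁ id)     ≈⟨ uncurry-natural g nil ⟩
        uncurry (g ∘ nil)           ≈⟨ uncurry-resp (proj₁ g-isFold) ⟩
        uncurry nil′                ≈⟨ uncurry-curry _ ⟩
        z ∘ λ′                      ∎) , (begin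
        uncurry g ∘ (cons ⊗₁ id)    ≈⟨ uncurry-natural g cons ⟩
        uncurry (g ∘ cons)          ≈⟨ uncurry-resp (Equiv.trans (proj₂ g-isFold) (cons′-natural g)) ⟩
        uncurry (curry (s ∘ ((id ⊗₁ uncurry g) ∘ α)))   ≈⟨ uncurry-curry _ ⟩
        s ∘ ((id ⊗₁ uncurry g) ∘ α) ∎)
      where
        g        = fold nil′ cons′
        g-isFold = fold-isFold nil′ cons′

    -- The transposes of both candidates are folds into the same algebra on `[X, Y ]`.
    paramFold-unique : ∀ {h k} → IsParamFold h → IsParamFold k → h ≈ k
    paramFold-unique {h} {k} p q = begin
      h                   ≈⟨ uncurry-curry h ⟨
      uncurry (curry h)   ≈⟨ uncurry-resp (fold-unique nil′ cons′ (curry-isFold p) (curry-isFold q)) ⟩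
      uncurry (curry k)   ≈⟨ uncurry-curry k ⟩
      k                   ∎

  -- Concatenation and its monoid laws.

  append : F ⊗₀ F ⇒ F
  append = paramFold id cons

  append-nil : append ∘ (nil ⊗₁ id) ≈ λ′
  append-nil = Equiv.trans (proj₁ (paramFold-isParamFold id cons)) identityˡ

  append-cons : append ∘ (cons ⊗₁ id) ≈ cons ∘ ((id ⊗₁ append) ∘ α)
  append-cons = proj₂ (paramFold-isParamFold id cons)

  -- Precomposition in the second argument only changes the starting value of the recursion. The
  -- instances `g = nil` and `g = append` give one side of the right unit law and of associativity.
  append∘⊗-isParamFold : ∀ {X} (g : X ⇒ F) → IsParamFold g cons (append ∘ (id ⊗₁ g))
  append∘⊗-isParamFold g = (begin
      (append ∘ (id ⊗₁ g)) ∘ (nil ⊗₁ id)     ≈⟨ pullʳ (Equiv.sym ⊗-interchange) ⟩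
      append ∘ ((nil ⊗₁ id) ∘ (id ⊗₁ g))     ≈⟨ pullˡ append-nil ⟩
      λ′ ∘ (id ⊗₁ g)                         ≈⟨ λ-natural g ⟩
      g ∘ λ′                                 ∎) , (begin
      (append ∘ (id ⊗₁ g)) ∘ (cons ⊗₁ id)    ≈⟨ pullʳ (Equiv.sym ⊗-interchange) ⟩
      append ∘ ((cons ⊗₁ id) ∘ (id ⊗₁ g))    ≈⟨ pullˡ append-cons ⟩
      (cons ∘ ((id ⊗₁ append) ∘ α)) ∘ (id ⊗₁ g)             ≈⟨ pullʳ (pullʳ (α-naturalʳ g)) ⟩
      cons ∘ ((id ⊗₁ append) ∘ ((id ⊗₁ (id ⊗₁ g)) ∘ α))     ≈⟨ refl⟩∘⟨ pullˡ (⊗-mergeʳ Equiv.refl) ⟩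
      cons ∘ ((id ⊗₁ (append ∘ (id ⊗₁ g))) ∘ α)             ∎)

  -- `ρ` solves the same recursion with parameter `I`: the `nil` equation is `λ≈ρ` and the `cons`
  -- equation is `ρ-α`, each after naturality of `ρ`.
  append-unitʳ : append ∘ (id ⊗₁ nil) ≈ ρ
  append-unitʳ = paramFold-unique nil cons (append∘⊗-isParamFold nil)
    ( Equiv.trans (ρ-natural nil) (refl⟩∘⟨ Equiv.sym λ≈ρ)
    , Equiv.trans (ρ-natural cons) (refl⟩∘⟨ Equiv.sym ρ-α))

  -- Inserting `α⁻¹ ∘ α` gives both sides the domain `F ⊗₀ (F ⊗₀ F)`, where they are recursions on
  -- the first factor with parameter `F ⊗₀ F` and starting value `append`.
  append-assoc : append ∘ (append ⊗₁ id) ≈ append ∘ ((id ⊗₁ append) ∘ α)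
  append-assoc = begin
    append ∘ (append ⊗₁ id)                     ≈⟨ identityʳ ⟨
    (append ∘ (append ⊗₁ id)) ∘ id              ≈⟨ refl⟩∘⟨ _≅_.isoˡ (associator F F F) ⟨
    (append ∘ (append ⊗₁ id)) ∘ (α⁻¹ ∘ α)       ≈⟨ Equiv.trans assoc (refl⟩∘⟨ Equiv.sym assoc) ⟩
    append ∘ (((append ⊗₁ id) ∘ α⁻¹) ∘ α)       ≈⟨ assoc ⟨
    (append ∘ ((append ⊗₁ id) ∘ α⁻¹)) ∘ α       ≈⟨ paramFold-unique append cons left-isParamFold (append∘⊗-isParamFold append) ⟩∘⟨refl ⟩
    (append ∘ (id ⊗₁ append)) ∘ α               ≈⟨ assoc ⟩
    append ∘ ((id ⊗₁ append) ∘ α)               ∎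
    where
      left-isParamFold : IsParamFold append cons (append ∘ ((append ⊗₁ id) ∘ α⁻¹))
      left-isParamFold = (begin
          (append ∘ ((append ⊗₁ id) ∘ α⁻¹)) ∘ (nil ⊗₁ id)
            ≈⟨ pullʳ (pullʳ (α⁻¹-naturalˡ nil)) ⟩
          append ∘ ((append ⊗₁ id) ∘ (((nil ⊗₁ id) ⊗₁ id) ∘ α⁻¹))
            ≈⟨ refl⟩∘⟨ pullˡ (⊗-mergeˡ append-nil) ⟩
          append ∘ ((λ′ ⊗₁ id) ∘ α⁻¹)
            ≈⟨ refl⟩∘⟨ λ-α ⟩∘⟨refl ⟨
          append ∘ ((λ′ ∘ α) ∘ α⁻¹)
            ≈⟨ refl⟩∘⟨ pullʳ (_≅_.isoʳ (associator _ _ _)) ⟩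
          append ∘ (λ′ ∘ id)
            ≈⟨ refl⟩∘⟨ identityʳ ⟩
          append ∘ λ′ ∎) , (begin
          (append ∘ ((append ⊗₁ id) ∘ α⁻¹)) ∘ (cons ⊗₁ id)
            ≈⟨ pullʳ (pullʳ (α⁻¹-naturalˡ cons)) ⟩
          append ∘ ((append ⊗₁ id) ∘ (((cons ⊗₁ id) ⊗₁ id) ∘ α⁻¹))
            ≈⟨ refl⟩∘⟨ pullˡ (⊗-mergeˡ append-cons) ⟩
          append ∘ (((cons ∘ ((id ⊗₁ append) ∘ α)) ⊗₁ id) ∘ α⁻¹)
            ≈⟨ refl⟩∘⟨ (Equiv.trans (refl⟩∘⟨ ⊗-mergeˡ Equiv.refl) (⊗-mergeˡ Equiv.refl)) ⟩∘⟨refl ⟨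
          append ∘ (((cons ⊗₁ id) ∘ (((id ⊗₁ append) ⊗₁ id) ∘ (α ⊗₁ id))) ∘ α⁻¹)
            ≈⟨ Equiv.trans (refl⟩∘⟨ Equiv.trans assoc (refl⟩∘⟨ assoc)) (pullˡ append-cons) ⟩
          (cons ∘ ((id ⊗₁ append) ∘ α)) ∘ (((id ⊗₁ append) ⊗₁ id) ∘ ((α ⊗₁ id) ∘ α⁻¹))
            ≈⟨ pullʳ (pullʳ (extendʳ (α-natural id append id))) ⟩
          cons ∘ ((id ⊗₁ append) ∘ ((id ⊗₁ (append ⊗₁ id)) ∘ (α ∘ ((α ⊗₁ id) ∘ α⁻¹))))
            -- This moves `α⁻¹` under `id ⊗₁`, where it joins the two `append`s to form the
            -- recursive call.
            ≈⟨ refl⟩∘⟨ refl⟩∘⟨ refl⟩∘⟨ pentagon⁻¹ ⟩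
          cons ∘ ((id ⊗₁ append) ∘ ((id ⊗₁ (append ⊗₁ id)) ∘ ((id ⊗₁ α⁻¹) ∘ α)))
            ≈⟨ refl⟩∘⟨ refl⟩∘⟨ pullˡ (⊗-mergeʳ Equiv.refl) ⟩
          cons ∘ ((id ⊗₁ append) ∘ ((id ⊗₁ ((append ⊗₁ id) ∘ α⁻¹)) ∘ α))
            ≈⟨ refl⟩∘⟨ pullˡ (⊗-mergeʳ Equiv.refl) ⟩
          cons ∘ ((id ⊗₁ (append ∘ ((append ⊗₁ id) ∘ α⁻¹))) ∘ α) ∎)

  listMonoid : Monoid V
  listMonoid = record
    { carrier    = F
    ; mult       = append
    ; unit       = nil
    ; mult-assoc = append-assoc
    ; unitˡ      = append-nil
    ; unitʳ      = append-unitʳ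
    }

  -- Inclusion of generators.

  singleton : A ⇒ F
  singleton = cons ∘ ((id ⊗₁ nil) ∘ ρ⁻¹)

  -- Expresses `cons` through the multiplication and the generators, which is what makes a monoid
  -- homomorphism determined by its values on `singleton`. The `nil` inside `singleton` is absorbed
  -- by `append-nil`, and the triangle turns the remaining `λ′` into a `ρ` that cancels `ρ⁻¹`.
  append-singleton : append ∘ (singleton ⊗₁ id) ≈ cons
  append-singleton = begin
    append ∘ (singleton ⊗₁ id)
      ≈⟨ refl⟩∘⟨ Equiv.trans (refl⟩∘⟨ ⊗-mergeˡ Equiv.refl) (⊗-mergeˡ Equiv.refl) ⟨
    append ∘ ((cons ⊗₁ id) ∘ (((id ⊗₁ nil) ⊗₁ id) ∘ (ρ⁻¹ ⊗₁ id)))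
      ≈⟨ pullˡ append-cons ⟩
    (cons ∘ ((id ⊗₁ append) ∘ α)) ∘ (((id ⊗₁ nil) ⊗₁ id) ∘ (ρ⁻¹ ⊗₁ id))
      ≈⟨ pullʳ (pullʳ (extendʳ (α-natural id nil id))) ⟩
    cons ∘ ((id ⊗₁ append) ∘ ((id ⊗₁ (nil ⊗₁ id)) ∘ (α ∘ (ρ⁻¹ ⊗₁ id))))
      ≈⟨ refl⟩∘⟨ pullˡ (⊗-mergeʳ append-nil) ⟩
    cons ∘ ((id ⊗₁ λ′) ∘ (α ∘ (ρ⁻¹ ⊗₁ id)))
      ≈⟨ refl⟩∘⟨ pullˡ triangle ⟩
    cons ∘ ((ρ ⊗₁ id) ∘ (ρ⁻¹ ⊗₁ id))
      ≈⟨ refl⟩∘⟨ Equiv.trans (⊗-mergeˡ (_≅_.isoʳ (unitorʳ A))) ⊗-id ⟩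
    cons ∘ id
      ≈⟨ identityʳ ⟩
    cons ∎

  -- The universal property.

  module _ (G : Monoid V) (f : A ⇒ Monoid.carrier G) where
    private
      module G = Monoid G

      step : A ⊗₀ G.carrier ⇒ G.carrier
      step = G.mult ∘ (f ⊗₁ id)

    extend : F ⇒ G.carrier
    extend = fold G.unit step

    private
      extend-nil : extend ∘ nil ≈ G.unit
      extend-nil = proj₁ (fold-isFold G.unit step)

      extend-cons : extend ∘ cons ≈ G.mult ∘ (f ⊗₁ extend)
      extend-cons = Equiv.trans (proj₂ (fold-isFold G.unit step))
                                (pullʳ (⊗-merge identityʳ identityˡ))

    -- Both sides are recursions in the first list with starting value `extend` and action `step`.
    -- For the right side, the `nil` equation is the left unit law of `G` and the `cons` equation is
    -- its associativity.
    extend-append : extend ∘ append ≈ G.mult ∘ (extend ⊗₁ extend)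
    extend-append = paramFold-unique extend step
      ((begin
        (extend ∘ append) ∘ (nil ⊗₁ id)                   ≈⟨ pullʳ append-nil ⟩
        extend ∘ λ′                                       ∎) , (begin
        (extend ∘ append) ∘ (cons ⊗₁ id)                  ≈⟨ pullʳ append-cons ⟩
        extend ∘ (cons ∘ ((id ⊗₁ append) ∘ α))            ≈⟨ extendʳ (proj₂ (fold-isFold G.unit step)) ⟩
        step ∘ ((id ⊗₁ extend) ∘ ((id ⊗₁ append) ∘ α))    ≈⟨ refl⟩∘⟨ pullˡ (⊗-mergeʳ Equiv.refl) ⟩
        step ∘ ((id ⊗₁ (extend ∘ append)) ∘ α)            ∎))
      ((begin
        (G.mult ∘ (extend ⊗₁ extend)) ∘ (nil ⊗₁ id)       ≈⟨ pullʳ (⊗-merge extend-nil identityʳ) ⟩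
        G.mult ∘ (G.unit ⊗₁ extend)                       ≈⟨ refl⟩∘⟨ ⊗-merge identityʳ identityˡ ⟨
        G.mult ∘ ((G.unit ⊗₁ id) ∘ (id ⊗₁ extend))        ≈⟨ pullˡ G.unitˡ ⟩
        λ′ ∘ (id ⊗₁ extend)                               ≈⟨ λ-natural extend ⟩
        extend ∘ λ′                                       ∎) , (begin
        (G.mult ∘ (extend ⊗₁ extend)) ∘ (cons ⊗₁ id)
          ≈⟨ pullʳ (⊗-merge extend-cons identityʳ) ⟩
        G.mult ∘ ((G.mult ∘ (f ⊗₁ extend)) ⊗₁ extend)
          ≈⟨ refl⟩∘⟨ ⊗-merge Equiv.refl identityˡ ⟨
        G.mult ∘ ((G.mult ⊗₁ id) ∘ ((f ⊗₁ extend) ⊗₁ extend))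
          ≈⟨ pullˡ G.mult-assoc ⟩
        (G.mult ∘ ((id ⊗₁ G.mult) ∘ α)) ∘ ((f ⊗₁ extend) ⊗₁ extend)
          ≈⟨ pullʳ (pullʳ (α-natural f extend extend)) ⟩
        G.mult ∘ ((id ⊗₁ G.mult) ∘ ((f ⊗₁ (extend ⊗₁ extend)) ∘ α))
          ≈⟨ refl⟩∘⟨ pullˡ (⊗-merge identityˡ Equiv.refl) ⟩
        G.mult ∘ ((f ⊗₁ (G.mult ∘ (extend ⊗₁ extend))) ∘ α)
          ≈⟨ refl⟩∘⟨ pullˡ (⊗-merge identityʳ identityˡ) ⟨
        G.mult ∘ ((f ⊗₁ id) ∘ ((id ⊗₁ (G.mult ∘ (extend ⊗₁ extend))) ∘ α))
          ≈⟨ assoc ⟨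
        step ∘ ((id ⊗₁ (G.mult ∘ (extend ⊗₁ extend))) ∘ α) ∎))

    extend-singleton : extend ∘ singleton ≈ f
    extend-singleton = begin
      extend ∘ (cons ∘ ((id ⊗₁ nil) ∘ ρ⁻¹))              ≈⟨ pullˡ extend-cons ⟩
      (G.mult ∘ (f ⊗₁ extend)) ∘ ((id ⊗₁ nil) ∘ ρ⁻¹)     ≈⟨ pullʳ (pullˡ (⊗-merge identityʳ extend-nil)) ⟩
      G.mult ∘ ((f ⊗₁ G.unit) ∘ ρ⁻¹)                     ≈⟨ refl⟩∘⟨ ⊗-merge identityˡ identityʳ ⟩∘⟨refl ⟨
      G.mult ∘ (((id ⊗₁ G.unit) ∘ (f ⊗₁ id)) ∘ ρ⁻¹)      ≈⟨ refl⟩∘⟨ assoc ⟩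
      -- The one-element list has been sent to `f` times the unit, so the right unit law of `G`
      -- finishes up to `ρ`.
      G.mult ∘ ((id ⊗₁ G.unit) ∘ ((f ⊗₁ id) ∘ ρ⁻¹))      ≈⟨ pullˡ G.unitʳ ⟩
      ρ ∘ ((f ⊗₁ id) ∘ ρ⁻¹)                              ≈⟨ extendʳ (ρ-natural f) ⟩
      f ∘ (ρ ∘ ρ⁻¹)                                      ≈⟨ refl⟩∘⟨ _≅_.isoʳ (unitorʳ A) ⟩
      f ∘ id                                             ≈⟨ identityʳ ⟩
      f                                                  ∎

    -- By `append-singleton`, preservation of multiplication yields the `cons` equation of the fold
    -- defining `extend`; preservation of the unit is its `nil` equation.
    extend-unique : (h : MonoidHom V listMonoid G) →
                    MonoidHom.hom h ∘ singleton ≈ f → MonoidHom.hom h ≈ extend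
    extend-unique h h-singleton = fold-unique G.unit step
      ( preserves-unit
      , (begin
        hom ∘ cons                                    ≈⟨ refl⟩∘⟨ append-singleton ⟨
        hom ∘ (append ∘ (singleton ⊗₁ id))            ≈⟨ extendʳ preserves-mult ⟩
        G.mult ∘ ((hom ⊗₁ hom) ∘ (singleton ⊗₁ id))   ≈⟨ refl⟩∘⟨ ⊗-merge h-singleton identityʳ ⟩
        G.mult ∘ (f ⊗₁ hom)                           ≈⟨ pullʳ (⊗-merge identityʳ identityˡ) ⟨
        step ∘ (id ⊗₁ hom)                            ∎))
      (fold-isFold G.unit step)
      where open MonoidHom h

  listFreeMonoid : FreeMonoid V A
  listFreeMonoid = record
    { monoid   = listMonoid
    ; ins      = singleton
    ; free     = λ G f → record
        { hom            = extend G f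
        ; preserves-unit = proj₁ (fold-isFold _ _)
        ; preserves-mult = extend-append G f
        }
    ; free-ins = extend-singleton
    ; unique   = extend-unique
    }

proposition2p7 : {o ℓ e : Level} (C : Category o ℓ e) (V : Monoidal C) →
    HasExponentials V →
    (coproducts : BinaryCoproducts C) →
    (μ : (A : Category.Obj C) → InitialAlgebra (I+_⊗- V coproducts A)) →
    (A : Category.Obj C) →
    Σ[ A* ∈ FreeMonoid V A ] (FreeMonoid.carrier A* ≡ InitialAlgebra.carrier (μ A))
proposition2p7 C V exponentials coproducts μ A =
  -- The monoid is built directly on the carrier of `μ A`, so the carriers agree definitionally and
  -- not just up to isomorphism.
  FreeMonoidConstruction.listFreeMonoid V exponentials coproducts A (μ A) , refl
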